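{- The layered $e$-adjacency tensor allows the retrieval of the distribution of the hb-edges: if $\mathcal{H}=(V,E)$ and $\mathcal{H}'=(V,E')$ are two natural hb-graphs on the same vertex set $V=\{v_1,\dots,v_n\}$, each with at least one hb-edge, no repeated hb-edge and no empty hb-edge, and if their layered $e$-adjacency tensors are equal, $\mathcal{A}_{\mathrm{lay}}(\mathcal{H})=\mathcal{A}_{\mathrm{lay}}(\mathcal{H}')$, then for every integer $j\geq 1$ $$\left|\{e\in E:\#_m e=j\}\right|=\left|\{e\in E':\#_m e=j\}\right|.$$
   Context: A natural multiset with universe $V$ is given by a multiplicity function $V\to\mathbb{N}$; its support is the set of elements of nonzero multiplicity and its m-cardinality $\#_m$ is the sum of its multiplicities. A natural hb-graph $\mathcal{H}=(V,E)$ consists of a nonempty finite set $V$ and a finite family $E=(e_i)_{i\in\{1,\dots,p\}}$ of natural multisets with universe $V$ (hb-edges); no repeated hb-edge means the $e_i$ are pairwise distinct. Write $m_{i\,j}$ for the multiplicity of $v_j$ in $e_i$, and $r_{\mathcal{H}}=\max_{e\in E}\#_m e$. The layered $e$-adjacency tensor $\mathcal{A}_{\mathrm{lay}}(\mathcal{H})$ is the symmetric hypermatrix of order $r_{\mathcal{H}}$ and dimension $n+r_{\mathcal{H}}-1$ equal to $\sum_{i=1}^pT_i$, where for $e_i=\{v_{j_1}^{m_{ij_1}},\ldots,v_{j_{k_i}}^{m_{ij_{k_i}}}\}$ (support $\{v_{j_1},\dots,v_{j_{k_i}}\}$) the nonzero entries of $T_i$ are exactly those whose index tuple is a permutation of the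 multiset $\{j_1^{m_{ij_1}},\ldots,j_{k_i}^{m_{ij_{k_i}}},(n+\#_m e_i)^{1},\ldots,(n+r_{\mathcal{H}}-1)^{1}\}$ (no added index if $\#_m e_i=r_{\mathcal{H}}$), all of them being equal to $\dfrac{m_{ij_1}!\cdots m_{ij_{k_i}}!}{(r_{\mathcal{H}}-1)!}$. Equality of two such tensors includes equality of their orders and dimensions. -}

module Defs where

open import Data.Bool.Base using (if_then_else_)
open import Data.Fin.Base as Fin using (Fin; toℕ)
open import Data.Fin.Properties as Fin using (all?)
open import Data.Integer.Base using (+_)
open import Data.List.Base as List using (List)
open import Data.Nat.Base using (ℕ; suc; _+_; _∸_; _⊔_; _!)
open import Data.Nat.Properties as ℕ using (_≟_; _≤?_; _!≢0)
open import Data.Product.Base using (Σ-syntax)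
open import Data.Rational.Base as ℚ using (ℚ; 0ℚ)
open import Data.Rational.Properties as ℚ using ()
open import Data.Vec.Base as Vec using (Vec)
open import Data.Vec.Functional as Vector using (Vector; _++_; foldr; replicate)
open import Relation.Binary.PropositionalEquality.Core using (_≡_; _≢_; _≗_)
open import Relation.Nullary.Decidable using (Dec; does)
open import Relation.Nullary.Negation using (¬_)

import Algebra.Properties.CommutativeMonoid.Sum as Sum

open Sum ℕ.+-0-commutativeMonoid public using () renaming (sum to sumℕ)
open Sum ℕ.*-1-commutativeMonoid public using () renaming (sum to productℕ)
open Sum ℚ.+-0-commutativeMonoid public using () renaming (sum to sumℚ)

-- A natural multiset with universe Fin n, given by its multiplicity function.
-- Two multisets are equal when their multiplicity functions agree pointwise (_≗_).
NatMultiset : ℕ → Set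
NatMultiset n = Vector ℕ n

∅ₘ : ∀ {n} → NatMultiset n
∅ₘ {n} = replicate n 0

#ₘ : ∀ {n} → NatMultiset n → ℕ
#ₘ = sumℕ

-- The vertex set {v₁,…,vₙ} is Fin n, the vertex vⱼ being the element with toℕ = j - 1.
record HbGraph (n : ℕ) : Set where
  field
    size : ℕ
    edge : Fin size → NatMultiset n

open HbGraph public

NoRepeatedEdge : ∀ {n} → HbGraph n → Set
NoRepeatedEdge H = ∀ i j → i ≢ j → ¬ (edge H i ≗ edge H j)

NoEmptyEdge : ∀ {n} → HbGraph n → Set
NoEmptyEdge H = ∀ i → ¬ (edge H i ≗ ∅ₘ)

-- The m-rank r_H, meaningful when there is at least one hb-edge (it is 0 otherwise).
rank : ∀ {n} → HbGraph n → ℕ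
rank H = foldr _⊔_ 0 (λ i → #ₘ (edge H i))

-- Under NoRepeatedEdge this is the cardinality of the set {e ∈ E : #ₘ e = j}.
edgesOfCard : ∀ {n} → HbGraph n → ℕ → ℕ
edgesOfCard H j =
  List.length (List.filter (λ i → #ₘ (edge H i) ≟ j) (List.allFin (size H)))

record Hypermatrix : Set where
  field
    order : ℕ
    dim   : ℕ
    entry : Vec (Fin dim) order → ℚ

open Hypermatrix public

-- Equality of orders, of dimensions, and of all entries; the casts only
-- transport an index tuple along the first two equalities.
infix 4 _≈ₕ_
_≈ₕ_ : Hypermatrix → Hypermatrix → Set
A ≈ₕ B =
  Σ[ o ∈ order A ≡ order B ] Σ[ d ∈ dim A ≡ dim B ]
    (∀ t → entry A t ≡ entry B (Vec.map (Fin.cast d) (Vec.cast o t)))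

-- A tuple is a permutation of (an exhaustive listing of) a multiset when
-- every element occurs in it as many times as its multiplicity.
IsPermutationOf : ∀ {d r} → Vec (Fin d) r → NatMultiset d → Set
IsPermutationOf t m = ∀ k → Vec.count (k Fin.≟_) t ≡ m k

isPermutationOf? : ∀ {d r} (t : Vec (Fin d) r) (m : NatMultiset d) →
                   Dec (IsPermutationOf t m)
isPermutationOf? t m = all? (λ k → Vec.count (k Fin.≟_) t ≟ m k)

-- The multiset {1^{m₁},…,n^{mₙ}, (n+#ₘe)^1,…,(n+r-1)^1}.  Position l of the
-- second block stands for the index n + (l+1), which is an added index
-- exactly when #ₘ e ≤ l + 1.
layered : ∀ {n} (r : ℕ) → NatMultiset n → NatMultiset (n + (r ∸ 1))
layered {n} r e = e ++ added
  where
  added : NatMultiset (r ∸ 1)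
  added l = if does (#ₘ e ≤? suc (toℕ l)) then 1 else 0

-- (m₁! ⋯ mₙ!) / (r-1)!; vertices outside the support contribute 0! = 1.
coefficient : ∀ {n} (r : ℕ) → NatMultiset n → ℚ
coefficient r e = ((+ productℕ (λ v → (e v) !)) ℚ./ ((r ∸ 1) !)) {{(r ∸ 1) !≢0}}

edgeTensor : ∀ {n} (r : ℕ) → NatMultiset n → Vec (Fin (n + (r ∸ 1))) r → ℚ
edgeTensor r e t =
  if does (isPermutationOf? t (layered r e)) then coefficient r e else 0ℚ

-- The dimension is written n + (r ∸ 1), which is n + r - 1 as soon as r ≥ 1.
-- Symmetry in the index tuple holds by construction, since edgeTensor only
-- depends on the number of occurrences of each index.
layeredTensor : ∀ {n} → HbGraph n → Hypermatrix
layeredTensor {n} H = record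
  { order = rank H
  ; dim   = n + (rank H ∸ 1)
  ; entry = λ t → sumℚ (λ i → edgeTensor (rank H) (edge H i) t)
  }

{-# OPTIONS --safe #-}

-- Listing the layered multiset of an hb-edge e gives an index tuple t at which
-- the tensor is positive, since every T_i is nonnegative.  If the tensors agree,
-- some hb-edge e′ of H′ therefore contributes at t, so that e and e′ have the
-- same layered multiset, hence e = e′.  Thus both hb-graphs have the same set of
-- hb-edges.
module Submission where

open import Defs
open import Data.Bool.Base using (true; false; if_then_else_)
open import Data.Fin.Base as Fin using (Fin; zero; suc; toℕ)
open import Data.Fin.Permutation using (Permutation; permutation; _⟨$⟩ʳ_)
open import Data.Fin.Properties as Fin using (any?)
open import Data.List.Base as List using ()
open import Data.Nat.Base
  using (ℕ; zero; suc; NonZero; _+_; _∸_; _≤_; _⊔_; z≤n; s≤s; _!)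
open import Data.Nat.Properties as ℕ using (_≟_; _≤?_; _!≢0)
open import Data.Product.Base using (∃-syntax; _,_; proj₁; proj₂)
open import Data.Rational.Base as ℚ using (ℚ; 0ℚ)
open import Data.Rational.Properties as ℚ using ()
open import Data.Sum.Base using (inj₁; inj₂)
open import Data.Vec.Base as Vec using (Vec)
open import Data.Vec.Properties as Vec using ()
open import Data.Vec.Functional using (Vector; _++_; foldr)
open import Data.Vec.Functional.Properties using (++-injectiveˡ)
open import Function.Base using (_∘_)
open import Relation.Binary.PropositionalEquality.Core
  using (_≡_; _≗_; refl; sym; trans; cong; subst)
open import Relation.Nullary.Decidable
  using (Dec; yes; no; does; dec-true; dec-false; decidable-stable)
open import Relation.Nullary.Negation using (¬_; contradiction)
open import Relation.Unary using (Decidable)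

import Algebra.Properties.CommutativeMonoid.Sum as Sum
open Sum ℕ.+-0-commutativeMonoid using (sum-permute; sum-cong-≗)
open Sum ℚ.+-0-commutativeMonoid using ()
  renaming (sum-cong-≗ to sumℚ-cong-≗; sum-replicate-zero to sumℚ-replicate-zero)

sumℚ-nonNeg : ∀ {n} (f : Vector ℚ n) → (∀ i → 0ℚ ℚ.≤ f i) → 0ℚ ℚ.≤ sumℚ f
sumℚ-nonNeg {zero}  f f≥0 = ℚ.≤-refl
sumℚ-nonNeg {suc n} f f≥0 = ℚ.+-mono-≤ (f≥0 zero) (sumℚ-nonNeg (f ∘ suc) (f≥0 ∘ suc))

-- Nonnegative summands cannot cancel, so an index tuple that one hb-edge contributes to keeps a
-- nonzero entry after all the hb-edges are added up.
sumℚ-pos : ∀ {n} (f : Vector ℚ n) → (∀ i → 0ℚ ℚ.≤ f i) →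
           ∀ i → 0ℚ ℚ.< f i → 0ℚ ℚ.< sumℚ f
sumℚ-pos f f≥0 zero    fi>0 =
  ℚ.+-mono-<-≤ fi>0 (sumℚ-nonNeg (f ∘ suc) (f≥0 ∘ suc))
sumℚ-pos f f≥0 (suc i) fi>0 =
  ℚ.+-mono-≤-< (f≥0 zero) (sumℚ-pos (f ∘ suc) (f≥0 ∘ suc) i fi>0)

sumℚ-zero : ∀ {n} (f : Vector ℚ n) → (∀ i → f i ≡ 0ℚ) → sumℚ f ≡ 0ℚ
sumℚ-zero {n} f f≡0 = trans (sumℚ-cong-≗ f≡0) (sumℚ-replicate-zero n)

product-nonZero : ∀ {n} (f : Vector ℕ n) → (∀ i → NonZero (f i)) → NonZero (productℕ f)
product-nonZero {zero}  f f≢0 = _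
product-nonZero {suc n} f f≢0 =
  ℕ.m*n≢0 (f zero) _ {{f≢0 zero}} {{product-nonZero (f ∘ suc) (f≢0 ∘ suc)}}

coefficient-pos : ∀ {n} r (e : NatMultiset n) → 0ℚ ℚ.< coefficient r e
coefficient-pos r e = ℚ.positive⁻¹ (coefficient r e)
  {{ℚ.normalize-pos (productℕ (λ v → e v !)) ((r ∸ 1) !)
      {{(r ∸ 1) !≢0}} {{product-nonZero (λ v → e v !) (λ v → e v !≢0)}}}}

if-yes : ∀ {P A : Set} (P? : Dec P) {x y : A} → P → (if does P? then x else y) ≡ x
if-yes P? {x} {y} p = cong (if_then x else y) (dec-true P? p)

if-no : ∀ {P A : Set} (P? : Dec P) {x y : A} → ¬ P → (if does P? then x else y) ≡ y
if-no P? {x} {y} ¬p = cong (if_then x else y) (dec-false P? ¬p)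

edgeTensor-on : ∀ {n} r (e : NatMultiset n) t → IsPermutationOf t (layered r e) →
                edgeTensor r e t ≡ coefficient r e
edgeTensor-on r e t = if-yes (isPermutationOf? t (layered r e))

edgeTensor-off : ∀ {n} r (e : NatMultiset n) t → ¬ IsPermutationOf t (layered r e) →
                 edgeTensor r e t ≡ 0ℚ
edgeTensor-off r e t = if-no (isPermutationOf? t (layered r e))

if-nonNeg : ∀ b {x : ℚ} → 0ℚ ℚ.≤ x → 0ℚ ℚ.≤ (if b then x else 0ℚ)
if-nonNeg true  x≥0 = x≥0
if-nonNeg false x≥0 = ℚ.≤-refl

edgeTensor-nonNeg : ∀ {n} r (e : NatMultiset n) t → 0ℚ ℚ.≤ edgeTensor r e t
edgeTensor-nonNeg r e t =
  if-nonNeg (does (isPermutationOf? t (layered r e))) (ℚ.<⇒≤ (coefficient-pos r e))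

count-zero : ∀ {d r} a (t : Vec (Fin d) r) →
  Vec.count (zero Fin.≟_) (Vec.replicate a zero Vec.++ Vec.map suc t) ≡ a
count-zero zero    Vec.[]      = refl
count-zero zero    (x Vec.∷ t) = count-zero zero t
count-zero (suc a) t           = cong suc (count-zero a t)

count-suc : ∀ {d r} a (t : Vec (Fin d) r) k →
  Vec.count (suc k Fin.≟_) (Vec.replicate a zero Vec.++ Vec.map suc t) ≡
  Vec.count (k Fin.≟_) t
count-suc zero    Vec.[]      k = refl
count-suc zero    (x Vec.∷ t) k with does (k Fin.≟ x)
... | true  = cong suc (count-suc zero t k)
... | false = count-suc zero t k
count-suc (suc a) t           k = count-suc a t k

listing : ∀ {d} (m : NatMultiset d) → Vec (Fin d) (#ₘ m)
listing {zero}  m = Vec.[]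
listing {suc d} m = Vec.replicate (m zero) zero Vec.++ Vec.map suc (listing (m ∘ suc))

listing-isPermutationOf : ∀ {d} (m : NatMultiset d) → IsPermutationOf (listing m) m
listing-isPermutationOf {suc d} m zero    = count-zero (m zero) (listing (m ∘ suc))
listing-isPermutationOf {suc d} m (suc k) =
  trans (count-suc (m zero) (listing (m ∘ suc)) k) (listing-isPermutationOf (m ∘ suc) k)

-- The m-cardinality enters through an equation, so that the tuple has length `r`, the order of the
-- tensor, without a cast.
∃-permutationOf : ∀ {d r} (m : NatMultiset d) → #ₘ m ≡ r →
                  ∃[ t ] IsPermutationOf {d} {r} t m
∃-permutationOf m refl = listing m , listing-isPermutationOf m

sum-++ : ∀ {m n} (f : Vector ℕ m) (g : Vector ℕ n) → sumℕ (f ++ g) ≡ sumℕ f + sumℕ g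
sum-++ {zero}  f g = refl
sum-++ {suc m} f g = trans
  (cong (f zero +_) (trans (sum-cong-≗ tail-++) (sum-++ (f ∘ suc) g)))
  (sym (ℕ.+-assoc (f zero) _ _))
  where
  -- Concatenation is defined through `splitAt`, so dropping the head agrees with the smaller
  -- concatenation only pointwise, after a case split.
  tail-++ : (f ++ g) ∘ suc ≗ (f ∘ suc) ++ g
  tail-++ i with Fin.splitAt m i
  ... | inj₁ _ = refl
  ... | inj₂ _ = refl

-- The successors match the shape of the added indices in layered.
sum-indicator-≤ : ∀ c r → c ≤ r →
  c + sumℕ {r} (λ l → if does (suc c ≤? suc (toℕ l)) then 1 else 0) ≡ r
sum-indicator-≤ zero    zero    z≤n       = refl
sum-indicator-≤ zero    (suc r) z≤n       = cong suc (sum-indicator-≤ zero r z≤n)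
sum-indicator-≤ (suc c) (suc r) (s≤s c≤r) = cong suc (sum-indicator-≤ c r c≤r)

-- The added indices from `n + #ₘ e` to `n + r - 1` number `r - #ₘ e` and fill the multiset up to
-- `r`. Only `r - 1` of them are available, hence the lower bound: for positive `r`, an empty
-- hb-edge would stop at `r - 1`.
#ₘ-layered : ∀ {n} r (e : NatMultiset n) → 1 ≤ #ₘ e → #ₘ e ≤ r → #ₘ (layered r e) ≡ r
#ₘ-layered (suc r) e 1≤#e #e≤r = trans (sum-++ e _) (total (#ₘ e) 1≤#e #e≤r)
  where
  -- The m-cardinality is generalised to a variable `c`, so that it can be matched as a successor.
  total : ∀ c → 1 ≤ c → c ≤ suc r →
    c + sumℕ {r} (λ l → if does (c ≤? suc (toℕ l)) then 1 else 0) ≡ suc r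
  total (suc c) _ (s≤s c≤r) = cong suc (sum-indicator-≤ c r c≤r)
#ₘ-layered zero e 1≤#e #e≤r = contradiction (ℕ.≤-trans 1≤#e #e≤r) λ ()

-- The order `r` is kept separate from the rank, so that both hb-graphs can be evaluated on the same
-- index tuples.
tensorEntry : ∀ {n} (r : ℕ) → HbGraph n → Vec (Fin (n + (r ∸ 1))) r → ℚ
tensorEntry r H t = sumℚ (λ i → edgeTensor r (edge H i) t)

edge-match : ∀ {n} r (H H′ : HbGraph n) →
  (∀ t → tensorEntry r H t ≡ tensorEntry r H′ t) →
  ∀ i → 1 ≤ #ₘ (edge H i) → #ₘ (edge H i) ≤ r → ∃[ i′ ] edge H i ≗ edge H′ i′
edge-match r H H′ eq i 1≤#e #e≤r
  with t , p ← ∃-permutationOf (layered r (edge H i)) (#ₘ-layered r (edge H i) 1≤#e #e≤r)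
  with any? (λ i′ → isPermutationOf? t (layered r (edge H′ i′)))
... | yes (i′ , p′) =
  -- Both multisets count the occurrences in the same `t`; the hb-edges are their restrictions to
  -- the first `n` indices.
  i′ , ++-injectiveˡ (edge H i) (edge H′ i′) (λ k → trans (sym (p k)) (p′ k))
... | no ¬p′ = contradiction (sym (trans (eq t) vanishes)) (ℚ.<⇒≢ positive)
  where
  positive : 0ℚ ℚ.< tensorEntry r H t
  positive = sumℚ-pos _ (λ i → edgeTensor-nonNeg r (edge H i) t) i
    (subst (0ℚ ℚ.<_) (sym (edgeTensor-on r (edge H i) t p)) (coefficient-pos r (edge H i)))
  vanishes : tensorEntry r H′ t ≡ 0ℚ
  vanishes = sumℚ-zero _ λ i′ → edgeTensor-off r (edge H′ i′) t (λ p′ → ¬p′ (i′ , p′))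

≤-max : ∀ {p} (f : Vector ℕ p) i → f i ≤ foldr _⊔_ 0 f
≤-max f zero    = ℕ.m≤m⊔n (f zero) _
≤-max f (suc i) = ℕ.≤-trans (≤-max (f ∘ suc) i) (ℕ.m≤n⊔m (f zero) _)

sum≡0⇒≗0 : ∀ {n} (f : Vector ℕ n) → sumℕ f ≡ 0 → ∀ i → f i ≡ 0
sum≡0⇒≗0 f eq zero    = ℕ.m+n≡0⇒m≡0 (f zero) eq
sum≡0⇒≗0 f eq (suc i) = sum≡0⇒≗0 (f ∘ suc) (ℕ.m+n≡0⇒n≡0 (f zero) eq) i

nonEmpty⇒1≤#ₘ : ∀ {n} (e : NatMultiset n) → ¬ (e ≗ ∅ₘ) → 1 ≤ #ₘ e
nonEmpty⇒1≤#ₘ e e≢∅ = ℕ.n≢0⇒n>0 (e≢∅ ∘ sum≡0⇒≗0 e)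

-- With the orders as variables, `o` can be matched with `refl`. Both dimensions then coincide, and
-- casting along `d` is the identity.
uncast-entries : ∀ {n} (H H′ : HbGraph n) {r r′} (o : r ≡ r′)
  (d : n + (r ∸ 1) ≡ n + (r′ ∸ 1)) →
  (∀ t → tensorEntry r H t ≡ tensorEntry r′ H′ (Vec.map (Fin.cast d) (Vec.cast o t))) →
  ∀ t → tensorEntry r H t ≡ tensorEntry r H′ t
uncast-entries H H′ {r} refl d eq t = trans (eq t) (cong (tensorEntry r H′)
  (trans (Vec.map-cong (Fin.cast-is-id d) _)
    (trans (Vec.map-id _) (Vec.cast-is-id refl t))))

-- A cardinality becomes a sum of indicators, which can be reindexed along a permutation.
length-filter-tabulate : ∀ {A : Set} {P : A → Set} (P? : Decidable P) {n} (f : Fin n → A) →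
  List.length (List.filter P? (List.tabulate f)) ≡
  sumℕ (λ i → if does (P? (f i)) then 1 else 0)
length-filter-tabulate P? {zero}  f = refl
length-filter-tabulate P? {suc n} f with does (P? (f zero))
... | true  = cong suc (length-filter-tabulate P? (f ∘ suc))
... | false = length-filter-tabulate P? (f ∘ suc)

noRepeat⇒injective : ∀ {n} (H : HbGraph n) → NoRepeatedEdge H →
                     ∀ {i j} → edge H i ≗ edge H j → i ≡ j
noRepeat⇒injective H nr {i} {j} eq = decidable-stable (i Fin.≟ j) λ i≢j → nr i j i≢j eq

edgesOfCard-permute : ∀ {n} (H H′ : HbGraph n) (π : Permutation (size H) (size H′)) →
  (∀ i → edge H i ≗ edge H′ (π ⟨$⟩ʳ i)) → ∀ j → edgesOfCard H j ≡ edgesOfCard H′ j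
edgesOfCard-permute H H′ π same j =
  trans (length-filter-tabulate (λ i → #ₘ (edge H i) ≟ j) (λ i → i))
  (trans (sum-cong-≗ λ i →
           cong (λ c → if does (c ≟ j) then 1 else 0) (sum-cong-≗ (same i)))
  (trans (sym (sum-permute (λ i → if does (#ₘ (edge H′ i) ≟ j) then 1 else 0) π))
         (sym (length-filter-tabulate (λ i → #ₘ (edge H′ i) ≟ j) (λ i → i)))))

claim5p2 : (n : ℕ) .{{_ : NonZero n}} (H H′ : HbGraph n) →
    1 ≤ size H → 1 ≤ size H′ →
    NoRepeatedEdge H → NoRepeatedEdge H′ →
    NoEmptyEdge H → NoEmptyEdge H′ →
    layeredTensor H ≈ₕ layeredTensor H′ →
    (j : ℕ) → 1 ≤ j → edgesOfCard H j ≡ edgesOfCard H′ j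
claim5p2 n H H′ _ _ nr nr′ ne ne′ (o , d , eq) j _ =
  edgesOfCard-permute H H′ π (proj₂ ∘ to) j
  where
  entries : ∀ t → tensorEntry (rank H) H t ≡ tensorEntry (rank H) H′ t
  entries = uncast-entries H H′ o d eq

  to : ∀ i → ∃[ i′ ] edge H i ≗ edge H′ i′
  to i = edge-match (rank H) H H′ entries i
    (nonEmpty⇒1≤#ₘ _ (ne i)) (≤-max (λ i → #ₘ (edge H i)) i)

  from : ∀ i′ → ∃[ i ] edge H′ i′ ≗ edge H i
  from i′ = edge-match (rank H) H′ H (sym ∘ entries) i′
    (nonEmpty⇒1≤#ₘ _ (ne′ i′))
    -- The maximum bounds by `rank H′`; equality of the orders turns this into `rank H`.
    (subst (#ₘ (edge H′ i′) ≤_) (sym o) (≤-max (λ i → #ₘ (edge H′ i)) i′))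

  π : Permutation (size H) (size H′)
  -- A round trip returns to an equal hb-edge, and as no hb-edge is repeated, to the same index.
  π = permutation (proj₁ ∘ to) (proj₁ ∘ from)
    (λ i′ → sym (noRepeat⇒injective H′ nr′ λ k →
      trans (proj₂ (from i′) k) (proj₂ (to _) k)))
    (λ i → sym (noRepeat⇒injective H nr λ k →
      trans (proj₂ (to i) k) (proj₂ (from _) k)))
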